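{- There exists an undirected, simple temporal graph $\mathcal{G}=(V,E,\lambda)$ such that no undirected, simple temporal graph $\mathcal{H}$ on the same vertex set $V$ satisfies $\mathcal{R}_{\mathrm{strict}}(\mathcal{H})\simeq\mathcal{R}_{\mathrm{non\text{ - }strict}}(\mathcal{G})$. Here $\mathcal{R}_{\mathrm{non\text{ - }strict}}(\mathcal{G})$ is the reachability graph of $\mathcal{G}$ computed with non-strict temporal paths and $\mathcal{R}_{\mathrm{strict}}(\mathcal{H})$ is the reachability graph of $\mathcal{H}$ computed with strict temporal paths. In other words, some graph in the setting UD \& non-strict \& simple has no reachability equivalent graph in the setting UD \& strict \& simple.
   Context: An undirected temporal graph is a triple $\mathcal{G}=(V,E,\lambda)$ with $V$ a finite vertex set, $E$ a set of 2-element subsets of $V$ (the footprint is $(V,E)$), and $\lambda\colon E\to 2^{\mathbb{N}}\setminus\{\emptyset\}$ assigning to each edge a nonempty finite set of time labels; a temporal edge is a pair $(e,t)$ with $t\in\lambda(e)$. $\mathcal{G}$ is simple if $|\lambda(e)|=1$ for every edge $e$. A temporal path from $u$ to $v$ is a sequence of temporal edges $(e_1,t_1),\dots,(e_k,t_k)$, $k\ge 1$, such that $e_1,\dots,e_k$ form a path from $u$ to $v$ in the footprint (distinct vertices) and $t_1\le t_2\le\dots\le t_k$; it is strict if $t_1<t_2<\dots<t_k$. In the strict setting reachability is defined by strict temporal paths, in the non-strict setting by all temporal paths. The reachability graph $\mathcal{R}(\mathcal{G})$ is the static directed graph on $V$ having an arc $(u,v)$, $u\neq v$, iff there is a temporal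 path (of the kind prescribed by the setting) from $u$ to $v$. Two temporal graphs on the same vertex set are reachability equivalent if their reachability graphs are isomorphic. -}

module Defs where

open import Data.Nat using (ℕ; _≤_; _<_)
open import Data.Fin using (Fin)
open import Data.Bool using (Bool; true)
open import Data.List using (List; []; _∷_; length)
open import Data.List.Relation.Unary.Unique.Propositional using (Unique)
open import Data.Product using (Σ; _×_; ∃)
open import Relation.Binary.PropositionalEquality using (_≡_)
open import Relation.Nullary using (¬_)
open import Function.Bundles using (_⤖_; Bijection)

-- An undirected, simple temporal graph on vertex set Fin n:
-- footprint given by a symmetric, irreflexive adjacency relation, and
-- each edge {u,v} carries exactly one time label lab u v = lab v u.
-- (lab u v is irrelevant when u and v are not adjacent.)
record SimpleTG (n : ℕ) : Set where
  field
    adj        : Fin n → Fin n → Bool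
    adj-sym    : ∀ u v → adj u v ≡ adj v u
    adj-irrefl : ∀ u → ¬ (adj u u ≡ true)
    lab        : Fin n → Fin n → ℕ
    lab-sym    : ∀ u v → lab u v ≡ lab v u
open SimpleTG public

data Setting : Set where
  strict nonStrict : Setting

_≼[_]_ : ℕ → Setting → ℕ → Set
s ≼[ strict ] t = s < t
s ≼[ nonStrict ] t = s ≤ t

data TWalkFrom {n : ℕ} (G : SimpleTG n) (σ : Setting) :
       ℕ → Fin n → Fin n → List (Fin n) → Set where
  one  : ∀ {t u v} → adj G u v ≡ true → t ≼[ σ ] lab G u v →
         TWalkFrom G σ t u v (u ∷ v ∷ [])
  step : ∀ {t u w v vs} → adj G u w ≡ true → t ≼[ σ ] lab G u w →
         TWalkFrom G σ (lab G u w) w v vs →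
         TWalkFrom G σ t u v (u ∷ vs)

data TPath {n : ℕ} (G : SimpleTG n) (σ : Setting) (u v : Fin n) : Set where
  single : adj G u v ≡ true → TPath G σ u v
  multi  : ∀ {w vs} → adj G u w ≡ true →
           TWalkFrom G σ (lab G u w) w v vs →
           Unique (u ∷ vs) → TPath G σ u v

Reach : {n : ℕ} → Setting → SimpleTG n → Fin n → Fin n → Set
Reach σ G u v = ¬ (u ≡ v) × TPath G σ u v

_≃R_ : {n : ℕ} → (Fin n → Fin n → Set) → (Fin n → Fin n → Set) → Set
_≃R_ {n} R S = Σ (Fin n ⤖ Fin n) λ f →
  ∀ u v → (R u v → S (Bijection.to f u) (Bijection.to f v)) × (S (Bijection.to f u) (Bijection.to f v) → R u v)

{-# OPTIONS --safe #-}

-- The witness G has the labels 01 : 1, 02 : 2, 04 : 3, 15 : 4, 12 : 5 and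
-- 03, 13 : 6, so that the path 0 – 3 – 1 at time 6 connects 0 and 1 a second
-- time, although the edge 01 already has time 1.  A graph H with the same strict
-- reachability can only use the nine pairs that reach each other.  Add the edges
-- of H in decreasing order of their labels, all edges of equal label at once,
-- and record the pairs joined by the edges added so far.  A pair outside the
-- target must never appear, and this leaves few enough orders that an exhaustive
-- search shows that the target is never attained.
module Submission where

open import Defs
open import Data.Bool using (Bool; true; false; _∧_; _∨_; not; if_then_else_)
import Data.Bool.Properties as Bool
open import Data.Empty using (⊥)
open import Data.Fin using (Fin; zero; suc; _≟_)
open import Data.Fin.Patterns
open import Data.Fin.Properties using (all?)
open import Data.List using (List; []; _∷_)
open import Data.List.Membership.Propositional using (_∈_; find; lose)
open import Data.List.Relation.Unary.All as All using (All; []; _∷_)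
open import Data.List.Relation.Unary.AllPairs using ([]; _∷_)
open import Data.List.Relation.Unary.Any using (any?; here; there)
open import Data.List.Relation.Unary.Unique.Propositional using (Unique)
open import Data.List.Relation.Unary.Unique.DecPropositional (_≟_ {6}) using (unique?)
open import Data.Nat using (ℕ; zero; suc; _≤_; _<_; _<ᵇ_; z≤n; _≤?_; _⊔_)
import Data.Nat.Properties as ℕ
open import Data.Product using (Σ; ∃; _×_; _,_; proj₁; proj₂; uncurry)
open import Data.Product.Properties using (≡-dec)
open import Data.List.Membership.DecPropositional (≡-dec (_≟_ {6}) (_≟_ {6})) using (_∈?_)
open import Data.Sum using (_⊎_; inj₁; inj₂; [_,_]′)
open import Data.Vec using (Vec; []; _∷_; lookup; updateAt; zipWith; tabulate; map)
open import Data.Vec.Properties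
  using (lookup∘updateAt; lookup∘updateAt′; lookup-zipWith; lookup∘tabulate)
open import Function using (_∘_)
open import Function.Bundles using (_⤖_; _⇔_; mk⇔; Equivalence; Bijection)
open import Relation.Binary.PropositionalEquality
  using (_≡_; _≢_; refl; sym; trans; cong; cong₂; subst; subst₂)
open import Relation.Nullary using (¬_; Dec; yes; no; does; contradiction)
open import Relation.Nullary.Decidable
  using (map′; _×-dec_; _⊎-dec_; _→-dec_; ¬?; True; toWitness; from-yes)

open Equivalence using (to; from)

private variable
  m n s t k : ℕ

-- Strict walks and strict paths

-- Walk G s u v: a strict walk, possibly empty, all of whose labels are at least s.
data Walk (G : SimpleTG n) : ℕ → Fin n → Fin n → Set where
  nil  : ∀ {u} → Walk G s u u
  cons : ∀ {u w v} → adj G u w ≡ true → s ≤ lab G u w →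
         Walk G (suc (lab G u w)) w v → Walk G s u v

module _ {G : SimpleTG n} where

  fromTWalk : ∀ {u v vs} → TWalkFrom G strict t u v vs → Walk G (suc t) u v
  fromTWalk (one a p)    = cons a p nil
  fromTWalk (step a p w) = cons a p (fromTWalk w)

  fromTPath : ∀ {u v} → TPath G strict u v → Walk G 0 u v
  fromTPath (single a)    = cons a z≤n nil
  fromTPath (multi a w _) = cons a z≤n (fromTWalk w)

  SimpleWalk : ℕ → Fin n → Fin n → Set
  SimpleWalk t u v = ∃ λ vs → TWalkFrom G strict t u v vs × Unique vs

  simpleWalk-weaken : ∀ {u v} → s ≤ t → SimpleWalk t u v → SimpleWalk s u v
  simpleWalk-weaken s≤t (_ , one a p , q)    = _ , one a (ℕ.≤-<-trans s≤t p) , q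
  simpleWalk-weaken s≤t (_ , step a p w , q) = _ , step a (ℕ.≤-<-trans s≤t p) w , q

  -- Cuts off everything before the occurrence of `u`. Labels increase along the walk, so the
  -- remaining suffix still respects the bound `t`; if `u` is the last vertex, nothing remains.
  simpleWalk-from : ∀ {u w v vs} → u ∈ vs → TWalkFrom G strict t w v vs → Unique vs →
                    u ≡ v ⊎ SimpleWalk t u v
  simpleWalk-from (here refl)         w@(one _ _)    q       = inj₂ (_ , w , q)
  simpleWalk-from (there (here refl)) (one _ _)      _       = inj₁ refl
  simpleWalk-from (here refl)         w@(step _ _ _) q       = inj₂ (_ , w , q)
  simpleWalk-from (there i)           (step _ p w)   (_ ∷ q) with simpleWalk-from i w q
  ... | inj₁ u≡v = inj₁ u≡v
  ... | inj₂ w′  = inj₂ (simpleWalk-weaken (ℕ.<⇒≤ p) w′)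

  ∉⇒All≢ : ∀ {u : Fin n} {vs} → ¬ (u ∈ vs) → All (u ≢_) vs
  ∉⇒All≢ {vs = []}    _ = []
  ∉⇒All≢ {vs = _ ∷ _} h = (h ∘ here) ∷ ∉⇒All≢ (h ∘ there)

  adj⇒≢ : ∀ {u v} → adj G u v ≡ true → u ≢ v
  adj⇒≢ a refl = adj-irrefl G _ a

  -- Loop removal by induction on the tail: if `u` recurs in the simplified tail, the suffix from
  -- that occurrence replaces the whole walk.
  simplify : ∀ {u v} → Walk G (suc t) u v → u ≡ v ⊎ SimpleWalk t u v
  simplify nil = inj₁ refl
  simplify {u = u} (cons a p w) with simplify w
  ... | inj₁ refl = inj₂ (_ , one a p , (adj⇒≢ a ∷ []) ∷ [] ∷ [])
  ... | inj₂ (vs , w′ , q) with any? (u ≟_) vs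
  ...   | no  u∉vs = inj₂ (_ , step a p w′ , ∉⇒All≢ u∉vs ∷ q)
  ...   | yes u∈vs with simpleWalk-from u∈vs w′ q
  ...     | inj₁ u≡v = inj₁ u≡v
  ...     | inj₂ w″  = inj₂ (simpleWalk-weaken (ℕ.<⇒≤ p) w″)

  simpleWalk⇒TPath : ∀ {u v} → SimpleWalk t u v → TPath G strict u v
  simpleWalk⇒TPath (_ , one a _ , _)    = single a
  simpleWalk⇒TPath (_ , step a _ w , q) = multi a w q

  -- `TWalkFrom` compares strictly with the preceding label, so `simplify` requires a successor as
  -- bound. The first edge, which may have label 0, is therefore split off; the bound of the tail is
  -- then a successor.
  toTPath : ∀ {u v} → u ≢ v → Walk G 0 u v → TPath G strict u v
  toTPath u≢v nil = contradiction refl u≢v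
  toTPath {u} u≢v (cons a _ w) with simplify w
  ... | inj₁ refl = single a
  ... | inj₂ (vs , w′ , q) with any? (u ≟_) vs
  ...   | no  u∉vs = multi a w′ (∉⇒All≢ u∉vs ∷ q)
  ...   | yes u∈vs with simpleWalk-from u∈vs w′ q
  ...     | inj₁ u≡v = contradiction u≡v u≢v
  ...     | inj₂ w″  = simpleWalk⇒TPath w″

reach⇔walk : (G : SimpleTG n) → ∀ {u v} → u ≢ v → Reach strict G u v ⇔ Walk G 0 u v
reach⇔walk G u≢v = mk⇔ (fromTPath ∘ proj₂) (λ w → u≢v , toTPath u≢v w)

-- Renaming vertices and bounding labels

walk-map : {G H : SimpleTG n} (h : Fin n → Fin n) →
           (∀ u v → adj H (h u) (h v) ≡ adj G u v) →
           (∀ u v → lab H (h u) (h v) ≡ lab G u v) →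
           ∀ {u v} → Walk G s u v → Walk H s (h u) (h v)
walk-map h a l nil = nil
walk-map {H = H} h a l {u} (cons {w = w} p q r) =
  cons (trans (a u w) p) (subst (_ ≤_) (sym (l u w)) q)
    (subst (λ i → Walk H (suc i) (h w) _) (sym (l u w)) (walk-map h a l r))

relabel : (Fin n → Fin n) → SimpleTG n → SimpleTG n
relabel g G = record
  { adj        = λ u v → adj G (g u) (g v)
  ; adj-sym    = λ u v → adj-sym G (g u) (g v)
  ; adj-irrefl = λ u → adj-irrefl G (g u)
  ; lab        = λ u v → lab G (g u) (g v)
  ; lab-sym    = λ u v → lab-sym G (g u) (g v)
  }

Fin-bounded : (f : Fin n → ℕ) → ∃ λ b → ∀ i → f i < b
Fin-bounded {zero}  f = 0 , λ ()
Fin-bounded {suc n} f with Fin-bounded (f ∘ suc)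
... | b , f<b = suc (f zero) ⊔ b , λ where
  zero    → ℕ.m≤m⊔n _ b
  (suc i) → ℕ.≤-trans (f<b i) (ℕ.m≤n⊔m (suc (f zero)) b)

lab-bounded : (G : SimpleTG n) → ∃ λ b → ∀ u v → lab G u v < b
lab-bounded G with Fin-bounded (λ u → proj₁ (Fin-bounded (lab G u)))
... | b , rows<b =
  b , λ u v → ℕ.<-trans (proj₂ (Fin-bounded (lab G u)) v) (rows<b u)

-- Boolean matrices

Matrix : ℕ → Set
Matrix n = Vec (Vec Bool n) n

Edge : ℕ → Set
Edge n = Fin n × Fin n

-- A record instead of a bare equation, so that unification recovers the matrix and the indices from
-- the type.
record Entry (R : Vec (Vec Bool n) m) (x : Fin m) (y : Fin n) : Set where
  constructor entry
  field holds : lookup (lookup R x) y ≡ true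

open Entry

entry? : (R : Vec (Vec Bool n) m) → ∀ x y → Dec (Entry R x y)
entry? R x y = map′ entry holds (lookup (lookup R x) y Bool.≟ true)

_⊑_ : Vec Bool n → Vec Bool n → Bool
[]           ⊑ []           = true
(true  ∷ xs) ⊑ (false ∷ ys) = false
(true  ∷ xs) ⊑ (true  ∷ ys) = xs ⊑ ys
(false ∷ xs) ⊑ (_     ∷ ys) = xs ⊑ ys

_⊑ᴹ_ : Vec (Vec Bool n) m → Vec (Vec Bool n) m → Bool
[]       ⊑ᴹ []       = true
(x ∷ xs) ⊑ᴹ (y ∷ ys) = (x ⊑ y) ∧ (xs ⊑ᴹ ys)

⊑-complete : (xs ys : Vec Bool n) →
             (∀ i → lookup xs i ≡ true → lookup ys i ≡ true) → xs ⊑ ys ≡ true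
⊑-complete []           []           h = refl
⊑-complete (true  ∷ xs) (true  ∷ ys) h = ⊑-complete xs ys (h ∘ suc)
⊑-complete (true  ∷ xs) (false ∷ ys) h = h zero refl
⊑-complete (false ∷ xs) (_     ∷ ys) h = ⊑-complete xs ys (h ∘ suc)

⊑ᴹ-complete : (P Q : Vec (Vec Bool n) m) →
              (∀ i j → Entry P i j → Entry Q i j) → P ⊑ᴹ Q ≡ true
⊑ᴹ-complete []      []      h = refl
⊑ᴹ-complete (x ∷ P) (y ∷ Q) h = cong₂ _∧_
  (⊑-complete x y λ j p → holds (h zero j (entry p)))
  (⊑ᴹ-complete P Q λ i j p → entry (holds (h (suc i) j (entry (holds p)))))

∨-true : ∀ a {b} → a ∨ b ≡ true → a ≡ true ⊎ b ≡ true
∨-true true  _ = inj₁ refl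
∨-true false p = inj₂ p

if-true : ∀ {a b c} → a ≡ true → (if a then b else c) ≡ true → b ≡ true
if-true refl p = p

identity : Matrix n
identity = tabulate λ x → tabulate λ y → does (x ≟ y)

identity-entry : (x y : Fin n) → lookup (lookup identity x) y ≡ does (x ≟ y)
identity-entry x y =
  trans (cong (λ r → lookup r y) (lookup∘tabulate _ x)) (lookup∘tabulate _ y)

identity-refl : (x : Fin n) → Entry identity x x
identity-refl x with x ≟ x in eq
... | yes _  = entry (trans (identity-entry x x) (cong does eq))
... | no x≢x = contradiction refl x≢x

identity-sound : (x y : Fin n) → Entry identity x y → x ≡ y
identity-sound x y (entry p) with x ≟ y in eq
... | yes x≡y = x≡y
... | no _ with () ← trans (sym p) (trans (identity-entry x y) (cong does eq))

module _ (R : Matrix n) (r : Vec Bool n) where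

  absorb : Fin n → Matrix n
  absorb x = updateAt R x (zipWith _∨_ r)

  absorb-row : ∀ x y → lookup (lookup (absorb x) x) y ≡ lookup r y ∨ lookup (lookup R x) y
  absorb-row x y = trans (cong (λ v → lookup v y) (lookup∘updateAt x R))
                         (lookup-zipWith _∨_ y r _)

  absorb-other : ∀ {x z} y → z ≢ x → lookup (lookup (absorb x) z) y ≡ lookup (lookup R z) y
  absorb-other {x} {z} y z≢x = cong (λ v → lookup v y) (lookup∘updateAt′ z x z≢x R)

  absorb-old : ∀ x {z y} → Entry R z y → Entry (absorb x) z y
  absorb-old x {z} {y} (entry p) with z ≟ x
  ... | yes refl =
    entry (trans (absorb-row x y) (trans (cong (lookup r y ∨_) p) (Bool.∨-zeroʳ _)))
  ... | no z≢x   = entry (trans (absorb-other y z≢x) p)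

  absorb-new : ∀ x {y} → lookup r y ≡ true → Entry (absorb x) x y
  absorb-new x {y} p = entry (trans (absorb-row x y) (cong (_∨ _) p))

  absorb-sound : ∀ x {z y} → Entry (absorb x) z y →
                 (z ≡ x × lookup r y ≡ true) ⊎ Entry R z y
  absorb-sound x {z} {y} (entry p) with z ≟ x
  ... | no z≢x   = inj₂ (entry (trans (sym (absorb-other y z≢x)) p))
  ... | yes refl with ∨-true (lookup r y) (trans (sym (absorb-row x y)) p)
  ...   | inj₁ q = inj₁ (refl , q)
  ...   | inj₂ q = inj₂ (entry q)

-- The exhaustive search

-- With R the relation joined by the later labels and R′ the one joined when the
-- chosen edges of the current label are included as well, both rows of R′ are
-- extended by rows of R: two edges with equal labels never follow each other.
include : Matrix n → Matrix n → Edge n → Matrix n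
include R R′ (x , y) = absorb (absorb R′ (lookup R y) x) (lookup R x) y

module Search (D : Matrix n) where

  -- An edge at the current label lets each endpoint reach whatever the other one reaches by later
  -- labels; both rows must stay inside `D`.
  compatible : Matrix n → Edge n → Bool
  compatible R (x , y) = (lookup R y ⊑ lookup D x) ∧ (lookup R x ⊑ lookup D y)

  -- In unattainable k R U, the relation R has been attained and the edges in U are
  -- unused; k bounds the number of labels still to come.  In noLayer k R R′ V U b,
  -- the edges in U are still undecided for the current label, those in V are left
  -- for earlier labels, and b says whether the current label has got an edge.
  unattainable : ℕ → Matrix n → List (Edge n) → Bool
  noLayer : ℕ → Matrix n → Matrix n → List (Edge n) → List (Edge n) → Bool → Bool

  -- Running out of fuel counts as failure, so `true` certifies a completed search.
  unattainable zero    R U = false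
  unattainable (suc k) R U = not (D ⊑ᴹ R) ∧ noLayer k R R [] U false

  noLayer k R R′ V []      false = true
  noLayer k R R′ V []      true  = unattainable k R′ V
  noLayer k R R′ V (e ∷ U) b     =
    noLayer k R R′ (e ∷ V) U b ∧
    -- The graph is simple: an edge chosen now has no further label and does not enter `V`.
    (if compatible R e then noLayer k R (include R R′ e) V U true else true)

-- Soundness of the search

module Soundness
  (D : Matrix n) (B : List (Edge n))
  (B-complete : ∀ x y → x ≢ y → Entry D x y → Entry D y x → (x , y) ∈ B ⊎ (y , x) ∈ B)
  (H : SimpleTG n) (walk⇔D : ∀ x y → Walk H 0 x y ⇔ Entry D x y) where

  open Search D

  Exact : ℕ → Matrix n → Set
  Exact s R = ∀ x y → Walk H s x y ⇔ Entry R x y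

  Adj : Edge n → Set
  Adj (x , y) = adj H x y ≡ true

  label : Edge n → ℕ
  label (x , y) = lab H x y

  Active : ℕ → Edge n → Set
  Active s e = Adj e × label e ≡ s

  active? : ∀ s e → Dec (Active s e)
  active? s (x , y) = (adj H x y Bool.≟ true) ×-dec (lab H x y ℕ.≟ s)

  Covers : ℕ → List (Edge n) → Set
  Covers s U = ∀ {e} → e ∈ B → Adj e → label e < s → e ∈ U

  Included : Matrix n → Matrix n → Edge n → Set
  Included R R′ (x , y) =
    (∀ {z} → Entry R y z → Entry R′ x z) × (∀ {z} → Entry R x z → Entry R′ y z)

  adj-flip : ∀ {x y} → adj H x y ≡ true → adj H y x ≡ true
  adj-flip {x} {y} = trans (adj-sym H y x)

  -- An edge of an undirected graph is a walk in both directions, so its endpoints are mutually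
  -- related in `D`.
  adj∈B : ∀ {x y} → adj H x y ≡ true → (x , y) ∈ B ⊎ (y , x) ∈ B
  adj∈B {x} {y} a = B-complete x y (adj⇒≢ {G = H} a)
    (to (walk⇔D x y) (cons a z≤n nil)) (to (walk⇔D y x) (cons (adj-flip a) z≤n nil))

  walk-weaken : ∀ {x y} → s ≤ t → Walk H t x y → Walk H s x y
  walk-weaken s≤t nil          = nil
  walk-weaken s≤t (cons a p w) = cons a (ℕ.≤-trans s≤t p) w

  prepend : ∀ {R x y z} → Exact (suc s) R → Active s (x , y) → Entry R y z → Walk H s x z
  prepend ex (a , refl) r = cons a ℕ.≤-refl (from (ex _ _) r)

  active-flip : ∀ {x y} → Active s (x , y) → Active s (y , x)
  active-flip (a , l) = adj-flip a , trans (lab-sym H _ _) l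

  active⇒row⊑ : ∀ {R} x y → Exact (suc s) R → Active s (x , y) →
                lookup R y ⊑ lookup D x ≡ true
  active⇒row⊑ {R = R} x y ex act = ⊑-complete (lookup R y) (lookup D x) λ z r →
    holds (to (walk⇔D x z) (walk-weaken z≤n (prepend ex act (entry r))))

  active⇒compatible : ∀ {R} e → Exact (suc s) R → Active s e → compatible R e ≡ true
  active⇒compatible (x , y) ex act =
    cong₂ _∧_ (active⇒row⊑ x y ex act) (active⇒row⊑ y x ex (active-flip act))

  -- Split a walk at its first edge. If that label exceeds `s`, the whole walk is already recorded
  -- in `R`; if it equals `s`, strictness puts the tail in `R`, and `Included` supplies the entry of
  -- `R′`.
  exact-step : ∀ {R R′} → Exact (suc s) R →
               (∀ {x y} → Entry R′ x y → Walk H s x y) →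
               (∀ {x y} → Entry R x y → Entry R′ x y) →
               (∀ {e} → e ∈ B → Active s e → Included R R′ e) → Exact s R′
  exact-step {s} {R} {R′} ex sound old new x y = mk⇔ complete sound
    where
    complete : ∀ {x y} → Walk H s x y → Entry R′ x y
    complete nil = old (to (ex _ _) nil)
    complete (cons {w = w} a p r) with ℕ.m≤n⇒m<n∨m≡n p
    ... | inj₁ s<l = old (to (ex _ _) (cons a s<l r))
    ... | inj₂ refl with adj∈B a
    ...   | inj₁ i = proj₁ (new i (a , refl)) (to (ex _ _) r)
    ...   | inj₂ i = proj₂ (new i (active-flip (a , refl))) (to (ex _ _) r)

  -- Follows the one branch of the search that `H` dictates: an edge is chosen exactly when it is
  -- active at `s`. The invariants say that `R′` lies between `R` and the walks from `s` on, that
  -- active edges are included or undecided, that edges with smaller labels are kept, and that the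
  -- layer is not empty.
  layer-sound : ∀ k {R} →
    (∀ {R′ V} → unattainable k R′ V ≡ true → Exact s R′ → Covers s V → ⊥) →
    Exact (suc s) R → ∀ U {V R′ b} → noLayer k R R′ V U b ≡ true →
    (∀ {x y} → Entry R′ x y → Walk H s x y) →
    (∀ {x y} → Entry R x y → Entry R′ x y) →
    (∀ {e} → e ∈ B → Active s e → Included R R′ e ⊎ e ∈ U) →
    (∀ {e} → e ∈ B → Adj e → label e < s → e ∈ V ⊎ e ∈ U) →
    b ≡ true ⊎ (∃ λ e → e ∈ U × Active s e) → ⊥
  layer-sound k next ex [] {b = false} _ _ _ _ _ (inj₂ (_ , () , _))
  layer-sound k next ex [] {b = true} c sound old new rest _ =
    next c (exact-step ex sound old (λ i act → [ (λ inc → inc) , (λ ()) ]′ (new i act)))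
           (λ i a l → [ (λ j → j) , (λ ()) ]′ (rest i a l))
  layer-sound {s = s} k {R} next ex (e ∷ U) {V} {R′} {b} c sound old new rest some
    with active? s e
  ... | no inactive =
    layer-sound k next ex U (Bool.∧-conicalˡ _ _ c) sound old new′ rest′ (some′ some)
    where
    new′ : ∀ {e′} → e′ ∈ B → Active s e′ → Included R R′ e′ ⊎ e′ ∈ U
    new′ i act with new i act
    ... | inj₁ inc         = inj₁ inc
    ... | inj₂ (here refl) = contradiction act inactive
    ... | inj₂ (there j)   = inj₂ j
    rest′ : ∀ {e′} → e′ ∈ B → Adj e′ → label e′ < s → e′ ∈ e ∷ V ⊎ e′ ∈ U
    rest′ i a l with rest i a l
    ... | inj₁ j         = inj₁ (there j)
    ... | inj₂ (here eq) = inj₁ (here eq)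
    ... | inj₂ (there j) = inj₂ j
    some′ : b ≡ true ⊎ (∃ λ e′ → e′ ∈ e ∷ U × Active s e′) →
            b ≡ true ⊎ (∃ λ e′ → e′ ∈ U × Active s e′)
    some′ (inj₁ p)                     = inj₁ p
    some′ (inj₂ (_ , here refl , act)) = contradiction act inactive
    some′ (inj₂ (_ , there j , act))   = inj₂ (_ , j , act)
  ... | yes act@(_ , l≡s) =
    layer-sound k next ex U
      (if-true (active⇒compatible e ex act) (Bool.∧-conicalʳ _ _ c))
      sound′ (old′ ∘ old) new′ rest′ (inj₁ refl)
    where
    x = proj₁ e
    y = proj₂ e
    R₁ = absorb R′ (lookup R y) x
    sound′ : ∀ {u v} → Entry (include R R′ e) u v → Walk H s u v
    sound′ p with absorb-sound R₁ (lookup R x) y p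
    ... | inj₁ (refl , r) = prepend ex (active-flip act) (entry r)
    ... | inj₂ q with absorb-sound R′ (lookup R y) x q
    ...   | inj₁ (refl , r) = prepend ex act (entry r)
    ...   | inj₂ r          = sound r
    old′ : ∀ {u v} → Entry R′ u v → Entry (include R R′ e) u v
    old′ = absorb-old R₁ (lookup R x) y ∘ absorb-old R′ (lookup R y) x
    new′ : ∀ {e′} → e′ ∈ B → Active s e′ → Included R (include R R′ e) e′ ⊎ e′ ∈ U
    new′ i act′ with new i act′
    ... | inj₁ (p , q)     = inj₁ (old′ ∘ p , old′ ∘ q)
    ... | inj₂ (here refl) = inj₁
      ( absorb-old R₁ (lookup R x) y ∘ absorb-new R′ (lookup R y) x ∘ holds
      , absorb-new R₁ (lookup R x) y ∘ holds )
    ... | inj₂ (there j)   = inj₂ j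
    rest′ : ∀ {e′} → e′ ∈ B → Adj e′ → label e′ < s → e′ ∈ V ⊎ e′ ∈ U
    rest′ i a l with rest i a l
    ... | inj₁ j           = inj₁ j
    -- The edge just chosen has label `s`, so it is not among those owed to earlier labels.
    ... | inj₂ (here refl) = contradiction l≡s (ℕ.<⇒≢ l)
    ... | inj₂ (there j)   = inj₂ j

  -- Descending induction on the label `s`. At 0 every walk is counted, so `R` contains `D`, which
  -- the test in `unattainable` has excluded.
  unattainable-sound : ∀ s k {R U} → unattainable k R U ≡ true → Exact s R → Covers s U → ⊥
  unattainable-sound zero (suc k) {R} c ex cov
    with () ← trans (sym (Bool.∧-conicalˡ _ _ c))
                (cong not (⊑ᴹ-complete D R λ x y → to (ex x y) ∘ from (walk⇔D x y)))
  unattainable-sound (suc s) (suc k) {R} {U} c ex cov with any? (active? s) B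
  ... | yes some =
    layer-sound k (unattainable-sound s k) ex U (Bool.∧-conicalʳ _ _ c)
      (λ r → walk-weaken (ℕ.n≤1+n s) (from (ex _ _) r)) (λ r → r)
      (λ { i (a , refl) → inj₂ (cov i a ℕ.≤-refl) })
      (λ i a l → inj₂ (cov i a (ℕ.m<n⇒m<1+n l)))
      (inj₂ (active∈U (find some)))
    where
    active∈U : (∃ λ e → e ∈ B × Active s e) → ∃ λ e → e ∈ U × Active s e
    active∈U (e , i , act@(a , refl)) = e , cov i a ℕ.≤-refl , act
  ... | no none =
    -- No edge has label `s`: the relation stays the same and no fuel is spent.
    unattainable-sound s (suc k) c
      (exact-step ex (λ r → walk-weaken (ℕ.n≤1+n s) (from (ex _ _) r)) (λ r → r)
        (λ i act → contradiction (lose i act) none))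
      (λ i a l → cov i a (ℕ.m<n⇒m<1+n l))

  unattainable-refutes : ∀ k → unattainable k identity B ≡ true → ⊥
  unattainable-refutes k c with lab-bounded H
  ... | b , lab<b = unattainable-sound b k c
    -- Above all labels only empty walks exist, so the search starts from `identity`.
    (λ x y → mk⇔ complete (λ p → subst (Walk H b x) (identity-sound x y p) nil))
    (λ i _ _ → i)
    where
    complete : ∀ {x y} → Walk H b x y → Entry identity x y
    complete nil          = identity-refl _
    complete (cons _ p _) = contradiction p (ℕ.<⇒≱ (lab<b _ _))

-- The counterexample on six vertices

-- The entry 0 means that there is no edge.
labels : Vec (Vec ℕ 6) 6
labels = (0 ∷ 1 ∷ 2 ∷ 6 ∷ 3 ∷ 0 ∷ [])
       ∷ (1 ∷ 0 ∷ 5 ∷ 6 ∷ 0 ∷ 4 ∷ [])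
       ∷ (2 ∷ 5 ∷ 0 ∷ 0 ∷ 0 ∷ 0 ∷ [])
       ∷ (6 ∷ 6 ∷ 0 ∷ 0 ∷ 0 ∷ 0 ∷ [])
       ∷ (3 ∷ 0 ∷ 0 ∷ 0 ∷ 0 ∷ 0 ∷ [])
       ∷ (0 ∷ 4 ∷ 0 ∷ 0 ∷ 0 ∷ 0 ∷ [])
       ∷ []

G₆ : SimpleTG 6
G₆ = record
  { adj        = λ u v → 0 <ᵇ l u v
  ; adj-sym    = λ u v → cong (0 <ᵇ_) (l-sym u v)
  ; adj-irrefl = from-yes (all? λ u → ¬? ((0 <ᵇ l u u) Bool.≟ true))
  ; lab        = l
  ; lab-sym    = l-sym
  }
  where
  l : Fin 6 → Fin 6 → ℕ
  l u v = lookup (lookup labels u) v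
  l-sym : ∀ u v → l u v ≡ l v u
  l-sym = from-yes (all? λ u → all? λ v → l u v ℕ.≟ l v u)

-- The latest label with which a non-strict temporal path from the row vertex to
-- the column vertex can start: 0 if there is none, and 6 on the diagonal.
latest : Vec (Vec ℕ 6) 6
latest = (6 ∷ 6 ∷ 2 ∷ 6 ∷ 3 ∷ 1 ∷ [])
       ∷ (6 ∷ 6 ∷ 5 ∷ 6 ∷ 1 ∷ 4 ∷ [])
       ∷ (5 ∷ 5 ∷ 6 ∷ 5 ∷ 2 ∷ 0 ∷ [])
       ∷ (6 ∷ 6 ∷ 0 ∷ 6 ∷ 0 ∷ 0 ∷ [])
       ∷ (3 ∷ 3 ∷ 0 ∷ 3 ∷ 6 ∷ 0 ∷ [])
       ∷ (4 ∷ 4 ∷ 4 ∷ 4 ∷ 0 ∷ 6 ∷ [])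
       ∷ []

departure : Fin 6 → Fin 6 → ℕ
departure u v = lookup (lookup latest u) v

target : Matrix 6
target = map (map (0 <ᵇ_)) latest

departure-edge : ∀ u v → adj G₆ u v ≡ true → lab G₆ u v ≤ departure u v
departure-edge = from-yes (all? λ u → all? λ v →
  (adj G₆ u v Bool.≟ true) →-dec (lab G₆ u v ≤? departure u v))

-- With `departure-edge`, this makes `departure` an upper bound for the start of every walk by
-- induction, so a finite check replaces an enumeration of paths.
departure-step : ∀ u w v → adj G₆ u w ≡ true → lab G₆ u w ≤ departure w v →
                 lab G₆ u w ≤ departure u v
departure-step = from-yes (all? λ u → all? λ w → all? λ v →
  (adj G₆ u w Bool.≟ true) →-dec
  ((lab G₆ u w ≤? departure w v) →-dec (lab G₆ u w ≤? departure u v)))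

adj⇒target : ∀ u w v → adj G₆ u w ≡ true → lab G₆ u w ≤ departure u v → Entry target u v
adj⇒target = from-yes (all? λ u → all? λ w → all? λ v →
  (adj G₆ u w Bool.≟ true) →-dec
  ((lab G₆ u w ≤? departure u v) →-dec (entry? target u v)))

walk≤departure : ∀ {u v vs} → TWalkFrom G₆ nonStrict t u v vs → t ≤ departure u v
walk≤departure {u = u} {v} (one a p) = ℕ.≤-trans p (departure-edge u v a)
walk≤departure {u = u} {v} (step {w = w} a p r) =
  ℕ.≤-trans p (departure-step u w v a (walk≤departure r))

path⇒target : ∀ {u v} → TPath G₆ nonStrict u v → Entry target u v
path⇒target {u} {v} (single a) = adj⇒target u v v a (departure-edge u v a)
path⇒target {u} {v} (multi {w = w} a r _) =
  adj⇒target u w v a (departure-step u w v a (walk≤departure r))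

via : ∀ {u v} w →
      {True (((adj G₆ u w Bool.≟ true) ×-dec (adj G₆ w v Bool.≟ true)) ×-dec
             ((lab G₆ u w ≤? lab G₆ w v) ×-dec unique? (u ∷ w ∷ v ∷ [])))} →
      TPath G₆ nonStrict u v
via {u} {v} w {p} with toWitness p
... | (a , b) , (c , d) = multi {w = w} a (one b c) d

detours : List (Edge 6)
detours = (0F , 5F) ∷ (1F , 4F) ∷ (2F , 3F) ∷ (2F , 4F) ∷ (4F , 1F) ∷ (4F , 3F)
        ∷ (5F , 0F) ∷ (5F , 2F) ∷ (5F , 3F) ∷ []

detour-paths : All (uncurry (TPath G₆ nonStrict)) detours
detour-paths = via 1F ∷ via 0F ∷ via 0F ∷ via 0F ∷ path₄₁ ∷ via 0F
             ∷ path₅₀ ∷ via 1F ∷ via 1F ∷ []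
  where
  -- The edge 01 has label 1, too early to follow label 3 or 4. Both remaining paths go round
  -- through vertex 3 with label 6 twice; these are the only listed paths that are not strict.
  path₄₁ : TPath G₆ nonStrict 4F 1F
  path₄₁ = multi {w = 0F} refl
    (step {w = 3F} refl (from-yes (3 ≤? 6)) (one refl (from-yes (6 ≤? 6))))
    (from-yes (unique? (4F ∷ 0F ∷ 3F ∷ 1F ∷ [])))
  path₅₀ : TPath G₆ nonStrict 5F 0F
  path₅₀ = multi {w = 1F} refl
    (step {w = 3F} refl (from-yes (4 ≤? 6)) (one refl (from-yes (6 ≤? 6))))
    (from-yes (unique? (5F ∷ 1F ∷ 3F ∷ 0F ∷ [])))

target⇒path : ∀ {u v} → u ≢ v → Entry target u v → TPath G₆ nonStrict u v
target⇒path {u} {v} u≢v e with cases u v u≢v e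
  where
  cases : ∀ u v → u ≢ v → Entry target u v → adj G₆ u v ≡ true ⊎ (u , v) ∈ detours
  cases = from-yes (all? λ u → all? λ v → ¬? (u ≟ v) →-dec
    ((entry? target u v) →-dec
     ((adj G₆ u v Bool.≟ true) ⊎-dec ((u , v) ∈? detours))))
... | inj₁ a = single a
... | inj₂ i = All.lookup detour-paths i

target-refl : ∀ u → Entry target u u
target-refl = from-yes (all? λ u → entry? target u u)

mutualPairs : List (Edge 6)
mutualPairs = (0F , 1F) ∷ (0F , 2F) ∷ (0F , 3F) ∷ (0F , 4F) ∷ (0F , 5F)
       ∷ (1F , 2F) ∷ (1F , 3F) ∷ (1F , 4F) ∷ (1F , 5F) ∷ []

mutualPairs-complete : ∀ u v → u ≢ v → Entry target u v → Entry target v u →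
                  (u , v) ∈ mutualPairs ⊎ (v , u) ∈ mutualPairs
mutualPairs-complete = from-yes (all? λ u → all? λ v → ¬? (u ≟ v) →-dec
  ((entry? target u v) →-dec
   ((entry? target v u) →-dec
    (((u , v) ∈? mutualPairs) ⊎-dec ((v , u) ∈? mutualPairs)))))

-- Each layer uses up at least one of the nine pairs, so there are at most nine layers; the tenth
-- unit of fuel serves the final test. The search itself is run by evaluation.
target-unattainable : Search.unattainable target 10 identity mutualPairs ≡ true
target-unattainable = refl

-- Transport along the isomorphism of reachability graphs

module _ (H : SimpleTG 6) (H≃G : Reach strict H ≃R Reach nonStrict G₆) where

  φ : Fin 6 ⤖ Fin 6
  φ = proj₁ H≃G

  f g : Fin 6 → Fin 6
  f = Bijection.to φ
  g y = proj₁ (Bijection.surjective φ y)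

  f∘g : ∀ y → f (g y) ≡ y
  f∘g y = proj₂ (Bijection.surjective φ y) refl

  g∘f : ∀ x → g (f x) ≡ x
  g∘f x = Bijection.injective φ (f∘g (f x))

  relabelled : SimpleTG 6
  relabelled = relabel g H

  -- Renaming `H` along the inverse `g` turns the isomorphism into equality of relations, so the
  -- search needs to consider only one labelling of the target.
  walk⇔target : ∀ x y → Walk relabelled 0 x y ⇔ Entry target x y
  walk⇔target x y with x ≟ y
  -- `Reach` excludes the diagonal, whereas empty walks and `target` both include it.
  ... | yes refl = mk⇔ (λ _ → target-refl x) (λ _ → nil)
  ... | no x≢y   = mk⇔ forth back
    where
    gx≢gy : g x ≢ g y
    gx≢gy eq = x≢y (trans (sym (f∘g x)) (trans (cong f eq) (f∘g y)))
    forth : Walk relabelled 0 x y → Entry target x y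
    forth w = subst₂ (Entry target) (f∘g x) (f∘g y)
      (path⇒target (proj₂ (proj₁ (proj₂ H≃G (g x) (g y))
        (from (reach⇔walk H gx≢gy) (walk-map g (λ _ _ → refl) (λ _ _ → refl) w)))))
    back : Entry target x y → Walk relabelled 0 x y
    back e = subst₂ (Walk relabelled 0) (f∘g x) (f∘g y)
      (walk-map f (λ u v → cong₂ (adj H) (g∘f u) (g∘f v))
                  (λ u v → cong₂ (lab H) (g∘f u) (g∘f v))
        (to (reach⇔walk H gx≢gy) (proj₂ (proj₂ H≃G (g x) (g y))
          (subst₂ (Reach nonStrict G₆) (sym (f∘g x)) (sym (f∘g y))
            (x≢y , target⇒path x≢y e)))))

theorem5 : Σ ℕ λ n → Σ (SimpleTG n) λ G →
    ∀ (H : SimpleTG n) → ¬ (Reach strict H ≃R Reach nonStrict G)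
theorem5 = 6 , G₆ , λ H iso →
  Soundness.unattainable-refutes target mutualPairs mutualPairs-complete
    (relabelled H iso) (walk⇔target H iso) 10 target-unattainable
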